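{- Let $H_1,H_2$ be vertex- and edge-disjoint hypergraphs. Then: (i) $T_{\mathrm{HG}}(H_1\cup H_2)=T_{\mathrm{HG}}(H_1)\,T_{\mathrm{HG}}(H_2)$, where $H_1\cup H_2$ is the disjoint union. (ii) Let $H_1*H_2$ be the vertex join of $H_1$ and $H_2$ obtained by identifying a vertex $v_1\in V(H_1)$ with a vertex $v_2\in V(H_2)$ into a single vertex $v$ (leaving all edges otherwise unchanged). Then $T_{\mathrm{HG}}(H_1*H_2)=T_{\mathrm{HG}}(H_1)\,T_{\mathrm{HG}}(H_2)$.
   Context: A hypergraph is a pair $H=(V,E)$ where $V$ is a finite set and $E$ is a finite multiset (parallel hyperedges are allowed and treated as distinct elements of $E$) of multisets of elements of $V$, called hyperedges. For $e\in E$, $d(e)$ is the size of $e$ counted with multiplicity; it is always assumed that $d(e)>1$. Write $v(H)=|V|$. $\kappa(H)$ is the number of connected components of the bipartite incidence graph with vertex classes $V$ and $E$, in which $u\in V$ and $e\in E$ are joined by as many edges as the multiplicity of $u$ in $e$. For $A\subseteq E$ let $\kappa(A)=\kappa((V,A))$, $d(A)=\sum_{e\in A}d(e)$, and $|A|$ is the number of hyperedges in $A$. Hypergraph Tutte polynomial: $T_{\mathrm{HG}}(H)=T_{\mathrm{HG}}(H;x,y)=\sum_{A\subseteq E}(x-1)^{\kappa(A)-\kappa(H)}(y-1)^{d(A)-|A|-v(H)+\kappa(A)}$. -}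

module Defs where

open import Level using (0ℓ)
open import Algebra.Bundles using (CommutativeRing)
import Algebra.Properties.Semiring.Exp as SemiringExp
import Algebra.Properties.Ring as RingProperties
import Algebra.Properties.CommutativeSemigroup as CommSemigroupProperties
open import Data.Nat using (ℕ; zero; suc; _+_; _∸_; _≤_; _<_; z≤n; pred)
import Data.Nat.Properties as ℕₚ
open import Data.Integer.Properties using (+-*-commutativeRing)
open import Data.Fin using (Fin; zero; suc; _↑ˡ_; _↑ʳ_; punchIn; punchOut; splitAt)
import Data.Fin.Properties as Finₚ
open import Data.List
  using (List; []; _∷_; _++_; map; foldr; length; lookup; sum; concatMap; allFin)
import Data.List.Properties as Listₚ
open import Data.List.Membership.Propositional using (_∈_)
open import Data.List.Membership.Propositional.Properties
  using (∈-map⁺; ∈-map⁻; ∈-++⁻; ∈-concatMap⁺; ∈-concatMap⁻; ∈-allFin)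
open import Data.List.Relation.Unary.Any using (here; there)
import Data.List.Relation.Unary.Any as Any
open import Data.Product using (∃; ∃₂; _×_; _,_; proj₁; proj₂)
open import Data.Sum using (_⊎_; inj₁; inj₂)
open import Function using (_∘_; Injective; StrictlySurjective)
open import Relation.Nullary using (yes; no; contradiction)
open import Relation.Binary using (IsEquivalence)
import Relation.Binary.Construct.On as On
open import Relation.Binary.Construct.Closure.Equivalence as EqC using (EqClosure)
open import Relation.Binary.Construct.Closure.ReflexiveTransitive using (ε; _◅_; _◅◅_)
open import Relation.Binary.Construct.Closure.Symmetric using (fwd; bwd)
open import Relation.Binary.PropositionalEquality
  using (_≡_; _≢_; refl; sym; trans; cong; cong₂; subst; isEquivalence; module ≡-Reasoning)

private
  variable
    n n₁ n₂ N : ℕ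

------------------------------------------------------------------------
-- Multigraphs and their connected components

-- A multigraph on Fin N is given by the list of its edges, each edge being
-- the pair of its endpoints; a pair occurring k times is k parallel edges.

Multigraph : ℕ → Set
Multigraph N = List (Fin N × Fin N)

Adjacent : Multigraph N → Fin N → Fin N → Set
Adjacent G a b = (a , b) ∈ G

-- The orientation of the pairs is forgotten by the symmetric closure.

Connected : Multigraph N → Fin N → Fin N → Set
Connected G = EqClosure (Adjacent G)

-- `label` exhibits Fin count as the set of connected components of G.

record Components (G : Multigraph N) : Set where
  field
    count    : ℕ
    label    : Fin N → Fin count
    surj     : StrictlySurjective _≡_ label
    sound    : ∀ {u w} → Connected G u w → label u ≡ label w
    complete : ∀ {u w} → label u ≡ label w → Connected G u w

private
  -- Identify j with i in Fin (suc k).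
  merge : ∀ {k} {i j : Fin (suc k)} → j ≢ i → Fin (suc k) → Fin k
  merge {j = j} j≢i c with j Finₚ.≟ c
  ... | yes _  = punchOut j≢i
  ... | no j≢c = punchOut j≢c

  merge-identifies : ∀ {k} {i j : Fin (suc k)} (j≢i : j ≢ i) →
                     merge j≢i i ≡ merge j≢i j
  merge-identifies {i = i} {j} j≢i with j Finₚ.≟ i | j Finₚ.≟ j
  ... | yes p | _      = contradiction p j≢i
  ... | no _  | yes _  = Finₚ.punchOut-cong j refl
  ... | no _  | no j≢j = contradiction refl j≢j

  merge-kernel : ∀ {k} {i j : Fin (suc k)} (j≢i : j ≢ i) c d →
                 merge j≢i c ≡ merge j≢i d →
                 c ≡ d ⊎ (i ≡ c × j ≡ d) ⊎ (i ≡ d × j ≡ c)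
  merge-kernel {i = i} {j} j≢i c d eq with j Finₚ.≟ c | j Finₚ.≟ d
  ... | yes p | yes q = inj₁ (trans (sym p) q)
  ... | yes p | no  q = inj₂ (inj₂ (Finₚ.punchOut-injective j≢i q eq , p))
  ... | no  p | yes q = inj₂ (inj₁ (sym (Finₚ.punchOut-injective p j≢i eq) , q))
  ... | no  p | no  q = inj₁ (Finₚ.punchOut-injective p q eq)

  merge-surj : ∀ {k} {i j : Fin (suc k)} (j≢i : j ≢ i) c →
               merge j≢i (punchIn j c) ≡ c
  merge-surj {j = j} j≢i c with j Finₚ.≟ punchIn j c
  ... | yes p = contradiction (sym p) (Finₚ.punchInᵢ≢i j c)
  ... | no  p = trans (Finₚ.punchOut-cong j refl) (Finₚ.punchOut-punchIn j)

  weaken : ∀ {G : Multigraph N} {e u w} → Connected G u w → Connected (e ∷ G) u w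
  weaken = EqC.map there

  -- An edge inside a component changes nothing.
  keepCount : ∀ {G : Multigraph N} {a b} (C : Components G) →
              Components.label C a ≡ Components.label C b → Components ((a , b) ∷ G)
  keepCount {G = G} {a} {b} C la≡lb = record
    { count    = count
    ; label    = label
    ; surj     = surj
    ; sound    = EqC.fold (On.isEquivalence label isEquivalence) λ
        { (here refl) → la≡lb
        ; (there e)   → sound (EqC.return e) }
    ; complete = weaken ∘ complete
    }
    where open Components C

  -- An edge between two components merges them.
  mergeCount : ∀ {G : Multigraph N} {a b k} (label : Fin N → Fin (suc k)) →
               StrictlySurjective _≡_ label →
               (∀ {u w} → Connected G u w → label u ≡ label w) →
               (∀ {u w} → label u ≡ label w → Connected G u w) →
               label b ≢ label a → Components ((a , b) ∷ G)
  mergeCount {N = N} {G = G} {a} {b} {k} label surj sound complete b≢a = record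
    { count    = k
    ; label    = merge b≢a ∘ label
    ; surj     = λ c → let u , eq = surj (punchIn (label b) c) in
        u , trans (cong (merge b≢a) eq) (merge-surj b≢a c)
    ; sound    = EqC.fold (On.isEquivalence (merge b≢a ∘ label) isEquivalence) λ
        { (here refl) → merge-identifies b≢a
        ; (there e)   → cong (merge b≢a) (sound (EqC.return e)) }
    ; complete = complete′
    }
    where
    complete′ : ∀ {u w} → merge b≢a (label u) ≡ merge b≢a (label w) →
                Connected ((a , b) ∷ G) u w
    complete′ {u} {w} eq with merge-kernel b≢a (label u) (label w) eq
    ... | inj₁ u≡w                = weaken (complete u≡w)
    ... | inj₂ (inj₁ (a≡u , b≡w)) =
      weaken (complete (sym a≡u)) ◅◅ fwd (here refl) ◅ weaken (complete b≡w)
    ... | inj₂ (inj₂ (a≡w , b≡u)) =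
      weaken (complete (sym b≡u)) ◅◅ bwd (here refl) ◅ weaken (complete a≡w)

  addEdge : ∀ {G : Multigraph N} a b → Components G → Components ((a , b) ∷ G)
  addEdge a b record { count = zero ; label = label } =
    contradiction (label a) Finₚ.¬Fin0
  addEdge a b C@record { count = suc k ; label = label ; surj = surj
                       ; sound = sound ; complete = complete }
    with label b Finₚ.≟ label a
  ... | yes b≡a = keepCount C (sym b≡a)
  ... | no  b≢a = mergeCount label surj sound complete b≢a

  addEdge-count : ∀ {G : Multigraph N} a b (C : Components G) →
                  Components.count C ≤ suc (Components.count (addEdge a b C))
  addEdge-count a b record { count = zero } = z≤n
  addEdge-count a b record { count = suc k ; label = label }
    with label b Finₚ.≟ label a
  ... | yes _ = ℕₚ.n≤1+n _
  ... | no  _ = ℕₚ.≤-refl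

components : (G : Multigraph N) → Components G
components {N = N} [] = record
  { count    = N
  ; label    = λ u → u
  ; surj     = λ u → u , refl
  ; sound    = EqC.fold isEquivalence λ ()
  ; complete = λ { refl → ε }
  }
components ((a , b) ∷ G) = addEdge a b (components G)

componentCount : Multigraph N → ℕ
componentCount G = Components.count (components G)

-- The cycle rank |E(G)| - N + (number of components) is nonnegative.

vertices≤edges+components : (G : Multigraph N) → N ≤ length G + componentCount G
vertices≤edges+components []            = ℕₚ.≤-refl
vertices≤edges+components {N = N} ((a , b) ∷ G) = begin
  N                                               ≤⟨ vertices≤edges+components G ⟩
  length G + componentCount G                     ≤⟨ ℕₚ.+-monoʳ-≤ (length G) (addEdge-count a b (components G)) ⟩
  length G + suc (componentCount ((a , b) ∷ G))   ≡⟨ ℕₚ.+-suc (length G) _ ⟩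
  suc (length G + componentCount ((a , b) ∷ G))   ∎
  where open ℕₚ.≤-Reasoning

------------------------------------------------------------------------
-- Hypergraphs

-- A multiset of vertices is represented by a list enumerating it with
-- multiplicity; the order of the list does not affect κ, d or T-HG.

record Hyperedge (n : ℕ) : Set where
  constructor hyperedge
  field
    ends   : List (Fin n)
    size>1 : 1 < length ends

open Hyperedge public

size : Hyperedge n → ℕ
size e = length (ends e)

-- Hypergraphs with vertex set Fin n.  The multiset E is also a list: parallel
-- hyperedges are distinguished by their positions.

record Hypergraph (n : ℕ) : Set where
  constructor hypergraph
  field
    E : List (Hyperedge n)

open Hypergraph public

-- The incidence graph has the vertex classes V = Fin n, embedded by
-- _↑ˡ length (E H), and E = Fin (length (E H)), embedded by n ↑ʳ_.

hyperedgeIncidences : (H : Hypergraph n) → Fin (length (E H)) →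
                      Multigraph (n + length (E H))
hyperedgeIncidences {n} H i =
  map (λ u → u ↑ˡ length (E H) , n ↑ʳ i) (ends (lookup (E H) i))

incidenceGraph : (H : Hypergraph n) → Multigraph (n + length (E H))
incidenceGraph H = concatMap (hyperedgeIncidences H) (allFin (length (E H)))

κ : Hypergraph n → ℕ
κ H = componentCount (incidenceGraph H)

d : List (Hyperedge n) → ℕ
d A = sum (map size A)

-- All subcollections A ⊆ E; they are selected by position, so a list of
-- length m has 2 ^ m of them even if it has repeated entries.

sublists : ∀ {a} {A : Set a} → List A → List (List A)
sublists []       = [] ∷ []
sublists (x ∷ xs) = map (x ∷_) (sublists xs) ++ sublists xs

mapHyperedge : (Fin n₁ → Fin n₂) → Hyperedge n₁ → Hyperedge n₂
mapHyperedge f (hyperedge us 1<us) =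
  hyperedge (map f us) (subst (1 <_) (sym (Listₚ.length-map f us)) 1<us)

infixr 6 _∪_

_∪_ : Hypergraph n₁ → Hypergraph n₂ → Hypergraph (n₁ + n₂)
_∪_ {n₁} {n₂} H₁ H₂ = hypergraph
  (map (mapHyperedge (_↑ˡ n₂)) (E H₁) ++ map (mapHyperedge (n₁ ↑ʳ_)) (E H₂))

-- The vertex set of the join is V(H₁) ⊎ (V(H₂) ∖ {v₂}), where punchOut
-- renumbers V(H₂) ∖ {v₂} as Fin (pred n₂); the vertex v is v₁.

joinʳ : Fin n₁ → Fin n₂ → Fin n₂ → Fin (n₁ + pred n₂)
joinʳ {n₁} {suc n₂} v₁ v₂ w with v₂ Finₚ.≟ w
... | yes _    = v₁ ↑ˡ n₂
... | no v₂≢w  = n₁ ↑ʳ punchOut v₂≢w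

vertexJoin : Hypergraph n₁ → Fin n₁ → Hypergraph n₂ → Fin n₂ →
             Hypergraph (n₁ + pred n₂)
vertexJoin {n₁} {n₂} H₁ v₁ H₂ v₂ = hypergraph
  (map (mapHyperedge (_↑ˡ pred n₂)) (E H₁) ++ map (mapHyperedge (joinʳ v₁ v₂)) (E H₂))

------------------------------------------------------------------------
-- Nonnegativity of the exponents in the Tutte polynomial

length-incidenceGraph : (H : Hypergraph n) → length (incidenceGraph H) ≡ d (E H)
length-incidenceGraph H =
  trans (go (allFin (length (E H)))) (cong sum sizes)
  where
  go : ∀ is → length (concatMap (hyperedgeIncidences H) is)
            ≡ sum (map (size ∘ lookup (E H)) is)
  go []       = refl
  go (i ∷ is) = trans (Listₚ.length-++ (hyperedgeIncidences H i))
    (cong₂ _+_ (Listₚ.length-map _ (ends (lookup (E H) i))) (go is))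
  sizes : map (size ∘ lookup (E H)) (allFin (length (E H))) ≡ map size (E H)
  sizes = trans (Listₚ.map-∘ (allFin _))
    (cong (map size) (trans (Listₚ.map-tabulate (λ i → i) (lookup (E H)))
                            (Listₚ.tabulate-lookup (E H))))

incident⁺ : (H : Hypergraph n) (i : Fin (length (E H))) {u : Fin n} →
            u ∈ ends (lookup (E H) i) →
            Adjacent (incidenceGraph H) (u ↑ˡ length (E H)) (n ↑ʳ i)
incident⁺ H i u∈e = ∈-concatMap⁺ (hyperedgeIncidences H)
  (Any.map (λ { refl → ∈-map⁺ _ u∈e }) (∈-allFin i))

incident⁻ : (H : Hypergraph n) {a b : Fin (n + length (E H))} →
            Adjacent (incidenceGraph H) a b →
            ∃₂ λ i u → u ∈ ends (lookup (E H) i) ×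
                       a ≡ u ↑ˡ length (E H) × b ≡ n ↑ʳ i
incident⁻ H ab with Any.satisfied (∈-concatMap⁻ (hyperedgeIncidences H) {xs = allFin _} ab)
... | i , ab∈i with ∈-map⁻ _ ab∈i
... | u , u∈e , refl = i , u , u∈e , refl , refl

-- Every component of the incidence graph contains an element of V.
vertexIn : (H : Hypergraph n) (c : Fin (κ H)) →
           ∃ λ u → Components.label (components (incidenceGraph H)) (u ↑ˡ length (E H)) ≡ c
vertexIn {n} H c with Components.surj (components (incidenceGraph H)) c
... | a , la≡c with splitAt n a in eq
... | inj₁ u = u , trans (cong label (Finₚ.splitAt⁻¹-↑ˡ eq)) la≡c
  where open Components (components (incidenceGraph H))
... | inj₂ i with lookup (E H) i in eq′
... | hyperedge (u ∷ _) _ = u , trans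
  (sound (EqC.return (incident⁺ H i (subst (λ e → u ∈ ends e) (sym eq′) (here refl)))))
  (trans (cong label (Finₚ.splitAt⁻¹-↑ʳ eq)) la≡c)
  where open Components (components (incidenceGraph H))

Embeds : ∀ {a} {X : Set a} → List X → List X → Set a
Embeds xs ys = ∃ λ (f : Fin (length xs) → Fin (length ys)) →
               ∀ i → lookup ys (f i) ≡ lookup xs i

sublists-embed : ∀ {a} {X : Set a} (xs : List X) {A} → A ∈ sublists xs → Embeds A xs
sublists-embed []       (here refl) = (λ i → i) , λ ()
sublists-embed (x ∷ xs) A∈ with ∈-++⁻ (map (x ∷_) (sublists xs)) A∈
... | inj₂ A∈xs = let f , f-ok = sublists-embed xs A∈xs in suc ∘ f , f-ok
... | inj₁ xA∈ with ∈-map⁻ (x ∷_) xA∈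
... | A , A∈xs , refl = let f , f-ok = sublists-embed xs A∈xs in
  (λ { zero → zero ; (suc i) → suc (f i) }) , λ { zero → refl ; (suc i) → f-ok i }

κ-embed : (A B : List (Hyperedge n)) → Embeds A B →
          κ (hypergraph B) ≤ κ (hypergraph A)
κ-embed {n} A B (f , f-ok) = Finₚ.injective⇒≤ {f = g} g-injective
  where
  HA = hypergraph A
  HB = hypergraph B
  module CA = Components (components (incidenceGraph HA))
  module CB = Components (components (incidenceGraph HB))

  h : Fin (n + length A) → Fin (n + length B)
  h a with splitAt n a
  ... | inj₁ u = u ↑ˡ length B
  ... | inj₂ i = n ↑ʳ f i

  hˡ : ∀ u → h (u ↑ˡ length A) ≡ u ↑ˡ length B
  hˡ u rewrite Finₚ.splitAt-↑ˡ n u (length A) = refl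

  hʳ : ∀ i → h (n ↑ʳ i) ≡ n ↑ʳ f i
  hʳ i rewrite Finₚ.splitAt-↑ʳ n (length A) i = refl

  h-adjacent : ∀ {a b} → Adjacent (incidenceGraph HA) a b →
               Adjacent (incidenceGraph HB) (h a) (h b)
  h-adjacent ab with incident⁻ HA ab
  ... | i , u , u∈e , refl , refl rewrite hˡ u | hʳ i =
    incident⁺ HB (f i) (subst (λ e → u ∈ ends e) (sym (f-ok i)) u∈e)

  g : Fin (κ HB) → Fin (κ HA)
  g c = CA.label (proj₁ (vertexIn HB c) ↑ˡ length A)

  g-injective : Injective _≡_ _≡_ g
  g-injective {c} {c′} eq = begin
    c                              ≡⟨ proj₂ (vertexIn HB c) ⟨
    CB.label (u ↑ˡ length B)       ≡⟨ cong CB.label (hˡ u) ⟨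
    CB.label (h (u ↑ˡ length A))   ≡⟨ CB.sound (EqC.gmap h h-adjacent (CA.complete eq)) ⟩
    CB.label (h (u′ ↑ˡ length A))  ≡⟨ cong CB.label (hˡ u′) ⟩
    CB.label (u′ ↑ˡ length B)      ≡⟨ proj₂ (vertexIn HB c′) ⟩
    c′                             ∎
    where
    open ≡-Reasoning
    u  = proj₁ (vertexIn HB c)
    u′ = proj₁ (vertexIn HB c′)

κ-antitone : (H : Hypergraph n) {A : List (Hyperedge n)} → A ∈ sublists (E H) →
             κ H ≤ κ (hypergraph A)
κ-antitone H {A} A∈ = κ-embed A (E H) (sublists-embed (E H) A∈)

nullity-nonneg : (A : List (Hyperedge n)) → length A + n ≤ d A + κ (hypergraph A)
nullity-nonneg {n} A = begin
  length A + n                                        ≡⟨ ℕₚ.+-comm (length A) n ⟩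
  n + length A                                        ≤⟨ vertices≤edges+components (incidenceGraph HA) ⟩
  length (incidenceGraph HA) + κ HA                   ≡⟨ cong (_+ κ HA) (length-incidenceGraph HA) ⟩
  d A + κ HA                                          ∎
  where
  open ℕₚ.≤-Reasoning
  HA = hypergraph A

------------------------------------------------------------------------
-- Polynomial rings

-- Univariate polynomials over R: lists of coefficients, constant term first,
-- considered up to equality of all coefficients (so trailing zeros are
-- irrelevant).

module Polynomial {c ℓ} (R : CommutativeRing c ℓ) where

  private
    module R = CommutativeRing R
  open R using (Carrier; 0#; 1#)

  Poly : Set c
  Poly = List Carrier

  coeff : Poly → ℕ → Carrier
  coeff []      _       = 0#
  coeff (a ∷ _) zero    = a
  coeff (_ ∷ p) (suc i) = coeff p i

  infix  4 _≋_
  infixl 6 _⊕_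
  infixl 7 _⊛_
  infixr 7 _·_

  record _≋_ (p q : Poly) : Set ℓ where
    constructor coeffwise
    field at : ∀ i → coeff p i R.≈ coeff q i

  open _≋_ public

  _⊕_ : Poly → Poly → Poly
  []      ⊕ q       = q
  (a ∷ p) ⊕ []      = a ∷ p
  (a ∷ p) ⊕ (b ∷ q) = (a R.+ b) ∷ (p ⊕ q)

  ⊖_ : Poly → Poly
  ⊖ p = map R.-_ p

  _·_ : Carrier → Poly → Poly
  a · p = map (a R.*_) p

  _⊛_ : Poly → Poly → Poly
  []      ⊛ q = []
  (a ∷ p) ⊛ q = (a · q) ⊕ (0# ∷ (p ⊛ q))

  const : Carrier → Poly
  const a = a ∷ []

  X : Poly
  X = 0# ∷ 1# ∷ []

  coeff-⊕ : ∀ p q i → coeff (p ⊕ q) i R.≈ coeff p i R.+ coeff q i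
  coeff-⊕ []      q       i       = R.sym (R.+-identityˡ _)
  coeff-⊕ (a ∷ p) []      i       = R.sym (R.+-identityʳ _)
  coeff-⊕ (a ∷ p) (b ∷ q) zero    = R.refl
  coeff-⊕ (a ∷ p) (b ∷ q) (suc i) = coeff-⊕ p q i

  coeff-⊖ : ∀ p i → coeff (⊖ p) i R.≈ R.- coeff p i
  coeff-⊖ []      i       = R.sym (RingProperties.-0#≈0# R.ring)
  coeff-⊖ (a ∷ p) zero    = R.refl
  coeff-⊖ (a ∷ p) (suc i) = coeff-⊖ p i

  coeff-· : ∀ a p i → coeff (a · p) i R.≈ a R.* coeff p i
  coeff-· a []      i       = R.sym (R.zeroʳ a)
  coeff-· a (b ∷ p) zero    = R.refl
  coeff-· a (b ∷ p) (suc i) = coeff-· a p i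

  private
    module +S = CommSemigroupProperties R.+-commutativeSemigroup
    open import Relation.Binary.Reasoning.Setoid R.setoid

  ≋-refl : ∀ {p} → p ≋ p
  ≋-refl = coeffwise λ _ → R.refl

  ≋-sym : ∀ {p q} → p ≋ q → q ≋ p
  ≋-sym e = coeffwise λ i → R.sym (at e i)

  ≋-trans : ∀ {p q r} → p ≋ q → q ≋ r → p ≋ r
  ≋-trans e f = coeffwise λ i → R.trans (at e i) (at f i)

  ⊕-cong : ∀ {p p′ q q′} → p ≋ p′ → q ≋ q′ → p ⊕ q ≋ p′ ⊕ q′
  ⊕-cong {p} {p′} {q} {q′} e f = coeffwise λ i → begin
    coeff (p ⊕ q) i            ≈⟨ coeff-⊕ p q i ⟩
    coeff p i R.+ coeff q i    ≈⟨ R.+-cong (at e i) (at f i) ⟩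
    coeff p′ i R.+ coeff q′ i  ≈⟨ coeff-⊕ p′ q′ i ⟨
    coeff (p′ ⊕ q′) i          ∎

  ⊖-cong : ∀ {p q} → p ≋ q → ⊖ p ≋ ⊖ q
  ⊖-cong {p} {q} e = coeffwise λ i →
    R.trans (coeff-⊖ p i) (R.trans (R.-‿cong (at e i)) (R.sym (coeff-⊖ q i)))

  ·-cong : ∀ a {p q} → p ≋ q → a · p ≋ a · q
  ·-cong a {p} {q} e = coeffwise λ i →
    R.trans (coeff-· a p i) (R.trans (R.*-congˡ (at e i)) (R.sym (coeff-· a q i)))

  ∷-cong : ∀ {a b p q} → a R.≈ b → p ≋ q → (a ∷ p) ≋ (b ∷ q)
  ∷-cong a≈b e = coeffwise λ { zero → a≈b ; (suc i) → at e i }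

  0∷[] : (0# ∷ []) ≋ []
  0∷[] = coeffwise λ { zero → R.refl ; (suc _) → R.refl }

  ⊕-assoc : ∀ p q r → (p ⊕ q) ⊕ r ≋ p ⊕ (q ⊕ r)
  ⊕-assoc p q r = coeffwise λ i → begin
    coeff ((p ⊕ q) ⊕ r) i                        ≈⟨ coeff-⊕ (p ⊕ q) r i ⟩
    coeff (p ⊕ q) i R.+ coeff r i                ≈⟨ R.+-congʳ (coeff-⊕ p q i) ⟩
    (coeff p i R.+ coeff q i) R.+ coeff r i      ≈⟨ R.+-assoc _ _ _ ⟩
    coeff p i R.+ (coeff q i R.+ coeff r i)      ≈⟨ R.+-congˡ (coeff-⊕ q r i) ⟨
    coeff p i R.+ coeff (q ⊕ r) i                ≈⟨ coeff-⊕ p (q ⊕ r) i ⟨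
    coeff (p ⊕ (q ⊕ r)) i                        ∎

  ⊕-comm : ∀ p q → p ⊕ q ≋ q ⊕ p
  ⊕-comm p q = coeffwise λ i →
    R.trans (coeff-⊕ p q i) (R.trans (R.+-comm _ _) (R.sym (coeff-⊕ q p i)))

  ⊕-identityˡ : ∀ p → [] ⊕ p ≋ p
  ⊕-identityˡ p = ≋-refl

  ⊕-identityʳ : ∀ p → p ⊕ [] ≋ p
  ⊕-identityʳ p = ⊕-comm p []

  ⊖-inverseʳ : ∀ p → p ⊕ (⊖ p) ≋ []
  ⊖-inverseʳ p = coeffwise λ i →
    R.trans (coeff-⊕ p (⊖ p) i) (R.trans (R.+-congˡ (coeff-⊖ p i)) (R.-‿inverseʳ _))

  ⊖-inverseˡ : ∀ p → (⊖ p) ⊕ p ≋ []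
  ⊖-inverseˡ p = ≋-trans (⊕-comm (⊖ p) p) (⊖-inverseʳ p)

  ⊕-interchange : ∀ p q r s → (p ⊕ q) ⊕ (r ⊕ s) ≋ (p ⊕ r) ⊕ (q ⊕ s)
  ⊕-interchange p q r s = coeffwise λ i → begin
    coeff ((p ⊕ q) ⊕ (r ⊕ s)) i                                   ≈⟨ four p q r s i ⟩
    (coeff p i R.+ coeff q i) R.+ (coeff r i R.+ coeff s i)       ≈⟨ +S.interchange _ _ _ _ ⟩
    (coeff p i R.+ coeff r i) R.+ (coeff q i R.+ coeff s i)       ≈⟨ four p r q s i ⟨
    coeff ((p ⊕ r) ⊕ (q ⊕ s)) i                                   ∎
    where
    four : ∀ p q r s i → coeff ((p ⊕ q) ⊕ (r ⊕ s)) i R.≈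
           (coeff p i R.+ coeff q i) R.+ (coeff r i R.+ coeff s i)
    four p q r s i = R.trans (coeff-⊕ (p ⊕ q) (r ⊕ s) i)
      (R.+-cong (coeff-⊕ p q i) (coeff-⊕ r s i))

  ·-distribˡ : ∀ a p q → a · (p ⊕ q) ≋ a · p ⊕ a · q
  ·-distribˡ a p q = coeffwise λ i → begin
    coeff (a · (p ⊕ q)) i                      ≈⟨ coeff-· a (p ⊕ q) i ⟩
    a R.* coeff (p ⊕ q) i                      ≈⟨ R.*-congˡ (coeff-⊕ p q i) ⟩
    a R.* (coeff p i R.+ coeff q i)            ≈⟨ R.distribˡ _ _ _ ⟩
    a R.* coeff p i R.+ a R.* coeff q i        ≈⟨ R.+-cong (coeff-· a p i) (coeff-· a q i) ⟨
    coeff (a · p) i R.+ coeff (a · q) i        ≈⟨ coeff-⊕ (a · p) (a · q) i ⟨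
    coeff (a · p ⊕ a · q) i                    ∎

  ·-· : ∀ a b p → (a R.* b) · p ≋ a · (b · p)
  ·-· a b p = coeffwise λ i → begin
    coeff ((a R.* b) · p) i    ≈⟨ coeff-· (a R.* b) p i ⟩
    a R.* b R.* coeff p i      ≈⟨ R.*-assoc _ _ _ ⟩
    a R.* (b R.* coeff p i)    ≈⟨ R.*-congˡ (coeff-· b p i) ⟨
    a R.* coeff (b · p) i      ≈⟨ coeff-· a (b · p) i ⟨
    coeff (a · (b · p)) i      ∎

  1·-identity : ∀ p → 1# · p ≋ p
  1·-identity p = coeffwise λ i → R.trans (coeff-· 1# p i) (R.*-identityˡ _)

  ∷-⊕ : ∀ p q → (0# ∷ p) ⊕ (0# ∷ q) ≋ 0# ∷ (p ⊕ q)
  ∷-⊕ p q = ∷-cong (R.+-identityˡ 0#) ≋-refl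

  ·-∷ : ∀ a p → a · (0# ∷ p) ≋ 0# ∷ (a · p)
  ·-∷ a p = ∷-cong (R.zeroʳ a) ≋-refl

  ⊛-congˡ : ∀ p {q q′} → q ≋ q′ → p ⊛ q ≋ p ⊛ q′
  ⊛-congˡ []      e = ≋-refl
  ⊛-congˡ (a ∷ p) e = ⊕-cong (·-cong a e) (∷-cong R.refl (⊛-congˡ p e))

  ⊛-zeroʳ : ∀ p → p ⊛ [] ≋ []
  ⊛-zeroʳ []      = ≋-refl
  ⊛-zeroʳ (a ∷ p) = ≋-trans (∷-cong R.refl (⊛-zeroʳ p)) 0∷[]

  ⊛-∷ʳ : ∀ q a p → q ⊛ (a ∷ p) ≋ a · q ⊕ (0# ∷ (q ⊛ p))
  ⊛-∷ʳ []      a p = ≋-sym 0∷[]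
  ⊛-∷ʳ (b ∷ q) a p = ∷-cong (R.+-congʳ (R.*-comm b a))
    (≋-trans (⊕-cong ≋-refl (⊛-∷ʳ q a p))
    (≋-trans (≋-sym (⊕-assoc (b · p) (a · q) _))
    (≋-trans (⊕-cong (⊕-comm (b · p) (a · q)) ≋-refl)
             (⊕-assoc (a · q) (b · p) _))))

  ⊛-comm : ∀ p q → p ⊛ q ≋ q ⊛ p
  ⊛-comm []      q = ≋-sym (⊛-zeroʳ q)
  ⊛-comm (a ∷ p) q =
    ≋-trans (⊕-cong ≋-refl (∷-cong R.refl (⊛-comm p q))) (≋-sym (⊛-∷ʳ q a p))

  ⊛-cong : ∀ {p p′ q q′} → p ≋ p′ → q ≋ q′ → p ⊛ q ≋ p′ ⊛ q′
  ⊛-cong {p} {p′} {q} {q′} e f =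
    ≋-trans (⊛-congˡ p f)
    (≋-trans (⊛-comm p q′) (≋-trans (⊛-congˡ q′ e) (⊛-comm q′ p′)))

  ⊛-distribˡ : ∀ r p q → r ⊛ (p ⊕ q) ≋ r ⊛ p ⊕ r ⊛ q
  ⊛-distribˡ []      p q = ≋-refl
  ⊛-distribˡ (a ∷ r) p q =
    ≋-trans (⊕-cong (·-distribˡ a p q)
              (≋-trans (∷-cong R.refl (⊛-distribˡ r p q)) (≋-sym (∷-⊕ (r ⊛ p) (r ⊛ q)))))
            (⊕-interchange (a · p) (a · q) (0# ∷ (r ⊛ p)) (0# ∷ (r ⊛ q)))

  ⊛-distribʳ : ∀ r p q → (p ⊕ q) ⊛ r ≋ p ⊛ r ⊕ q ⊛ r
  ⊛-distribʳ r p q =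
    ≋-trans (⊛-comm (p ⊕ q) r)
    (≋-trans (⊛-distribˡ r p q) (⊕-cong (⊛-comm r p) (⊛-comm r q)))

  0∷-⊛ : ∀ p q → (0# ∷ p) ⊛ q ≋ 0# ∷ (p ⊛ q)
  0∷-⊛ p q = ⊕-cong {q = 0# ∷ (p ⊛ q)}
    (coeffwise {q = []} λ i → R.trans (coeff-· 0# q i) (R.zeroˡ _)) ≋-refl

  ·-⊛ : ∀ a p q → (a · p) ⊛ q ≋ a · (p ⊛ q)
  ·-⊛ a []      q = ≋-refl
  ·-⊛ a (b ∷ p) q = ≋-trans
    (⊕-cong (·-· a b q)
      (≋-trans (∷-cong R.refl (·-⊛ a p q)) (≋-sym (·-∷ a (p ⊛ q)))))
    (≋-sym (·-distribˡ a (b · q) (0# ∷ (p ⊛ q))))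

  ⊛-assoc : ∀ p q r → (p ⊛ q) ⊛ r ≋ p ⊛ (q ⊛ r)
  ⊛-assoc []      q r = ≋-refl
  ⊛-assoc (a ∷ p) q r =
    ≋-trans (⊛-distribʳ r (a · q) (0# ∷ (p ⊛ q)))
    (⊕-cong (·-⊛ a q r)
            (≋-trans (0∷-⊛ (p ⊛ q) r) (∷-cong R.refl (⊛-assoc p q r))))

  ⊛-identityˡ : ∀ p → const 1# ⊛ p ≋ p
  ⊛-identityˡ p = ≋-trans (⊕-cong (1·-identity p) 0∷[]) (⊕-identityʳ p)

  ⊛-identityʳ : ∀ p → p ⊛ const 1# ≋ p
  ⊛-identityʳ p = ≋-trans (⊛-comm p (const 1#)) (⊛-identityˡ p)

  commutativeRing : CommutativeRing c ℓ
  commutativeRing = record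
    { Carrier = Poly
    ; _≈_     = _≋_
    ; _+_     = _⊕_
    ; _*_     = _⊛_
    ; -_      = ⊖_
    ; 0#      = []
    ; 1#      = const 1#
    ; isCommutativeRing = record
      { isRing = record
        { +-isAbelianGroup = record
          { isGroup = record
            { isMonoid = record
              { isSemigroup = record
                { isMagma = record
                  { isEquivalence = record
                    { refl = ≋-refl ; sym = ≋-sym ; trans = ≋-trans }
                  ; ∙-cong = ⊕-cong
                  }
                ; assoc = ⊕-assoc
                }
              ; identity = ⊕-identityˡ , ⊕-identityʳ
              }
            ; inverse = ⊖-inverseˡ , ⊖-inverseʳ
            ; ⁻¹-cong = ⊖-cong
            }
          ; comm = ⊕-comm
          }
        ; *-cong     = ⊛-cong
        ; *-assoc    = ⊛-assoc
        ; *-identity = ⊛-identityˡ , ⊛-identityʳ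
        ; distrib    = ⊛-distribˡ , ⊛-distribʳ
        }
      ; *-comm = ⊛-comm
      }
    }

ℤ[x] : CommutativeRing 0ℓ 0ℓ
ℤ[x] = Polynomial.commutativeRing +-*-commutativeRing

ℤ[x,y] : CommutativeRing 0ℓ 0ℓ
ℤ[x,y] = Polynomial.commutativeRing ℤ[x]

x y : CommutativeRing.Carrier ℤ[x,y]
x = Polynomial.const ℤ[x] (Polynomial.X +-*-commutativeRing)
y = Polynomial.X ℤ[x]

------------------------------------------------------------------------
-- The hypergraph Tutte polynomial

-- T(H; x, y) at two elements x, y of a commutative ring.  By κ-antitone and
-- nullity-nonneg both truncated subtractions are exact.

module _ {c ℓ} (R : CommutativeRing c ℓ) where

  private module R = CommutativeRing R
  open SemiringExp R.semiring using (_^_)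

  tutteTerm : R.Carrier → R.Carrier → Hypergraph n → List (Hyperedge n) → R.Carrier
  tutteTerm {n} x y H A =
    (x R.- R.1#) ^ (κ (hypergraph A) ∸ κ H) R.*
    (y R.- R.1#) ^ ((d A + κ (hypergraph A)) ∸ (length A + n))

  tutte : R.Carrier → R.Carrier → Hypergraph n → R.Carrier
  tutte x y H = foldr R._+_ R.0# (map (tutteTerm x y H) (sublists (E H)))

T-HG : Hypergraph n → CommutativeRing.Carrier ℤ[x,y]
T-HG = tutte ℤ[x,y] x y

open CommutativeRing ℤ[x,y] public using (_≈_; _*_)

{-# OPTIONS --safe #-}

-- The components of a hypergraph form the coequalizer of its hyperedges: a
-- map on V that is constant on every hyperedge factors uniquely through
-- them.  Both H₁ ∪ H₂ and H₁ * H₂ have as vertex set a pushout V₁ ← P → V₂,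
-- with P empty or a point.  Colimits commute, so the components of A ⊔ B are
-- the pushout of those of A and of B over the same P.  Hence κ and v both
-- drop by |P| below their sum over the two parts, the drop cancels in both
-- exponents, and the sum over A ⊔ B factors.

module Submission where

open import Defs
open import Algebra.Bundles using (CommutativeRing)
import Algebra.Properties.CommutativeSemigroup as CommSemigroupProperties
import Algebra.Properties.Semiring.Exp as SemiringExp
open import Data.Empty using (⊥)
open import Data.Fin using (Fin; _↑ˡ_; _↑ʳ_; punchIn; splitAt)
import Data.Fin.Properties as Finₚ
open import Data.List
  using (List; []; _∷_; _++_; map; foldr; length; lookup; cartesianProductWith)
import Data.List.Properties as Listₚ
open import Data.List.Membership.Propositional using (_∈_)
open import Data.List.Membership.Propositional.Properties
  using (∈-map⁺; ∈-map⁻; ∈-++⁺ˡ; ∈-++⁺ʳ; ∈-++⁻; ∈-lookup)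
open import Data.List.Relation.Unary.Any using (here; there; index)
open import Data.List.Relation.Unary.Any.Properties using (lookup-index)
open import Data.Nat using (ℕ; suc; _+_; _∸_; _≤_; pred)
open import Data.Nat.ListAction using (sum)
open import Data.Nat.ListAction.Properties using (sum-++)
import Data.Nat.Properties as ℕₚ
open import Data.Product using (∃; _×_; _,_; proj₁; proj₂)
open import Data.Sum using (_⊎_; inj₁; inj₂; [_,_]′)
open import Data.Unit using (⊤; tt)
open import Function using (_∘_; StrictlySurjective)
open import Relation.Binary.Construct.Closure.Equivalence as EqC using ()
import Relation.Binary.Construct.On as On
open import Relation.Binary.PropositionalEquality
  using (_≡_; refl; sym; trans; cong; cong₂; subst; isEquivalence; module ≡-Reasoning)
open import Relation.Nullary using (yes; no; contradiction)

private
  variable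
    n n₁ n₂ k k₁ k₂ m : ℕ
    P : Set

-- Components as a coequalizer

Constant : ∀ {X : Set} → (Fin n → X) → List (Hyperedge n) → Set
Constant φ A = ∀ {e} → e ∈ A → ∀ {u w} → u ∈ ends e → w ∈ ends e → φ u ≡ φ w

-- The universal property is stated on vertices alone: the hyperedge nodes of the incidence graph,
-- whose numbering changes under gluing, do not enter. Uniqueness of `ψ` follows from `surj`.
record Labelling (A : List (Hyperedge n)) (k : ℕ) : Set where
  field
    label    : Fin n → Fin k
    surj     : StrictlySurjective _≡_ label
    constant : Constant label A
    factor   : (φ : Fin n → Fin m) → Constant φ A →
               ∃ λ (ψ : Fin k → Fin m) → ∀ u → ψ (label u) ≡ φ u

-- Each labelling factors through the other. The composite `from ∘ to` fixes the label of every
-- vertex, and by surjectivity these are all elements of `Fin k₁`, so `to` is injective.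
labelling-≤ : {A : List (Hyperedge n)} → Labelling A k₁ → Labelling A k₂ → k₁ ≤ k₂
labelling-≤ {k₁ = k₁} L M = Finₚ.injective⇒≤ {f = to} λ {c} {c′} eq →
  trans (sym (from∘to c)) (trans (cong from eq) (from∘to c′))
  where
  module L = Labelling L
  module M = Labelling M
  to   = proj₁ (L.factor M.label M.constant)
  from = proj₁ (M.factor L.label L.constant)

  from∘to : (c : Fin k₁) → from (to c) ≡ c
  from∘to c with L.surj c
  ... | u , refl = trans (cong from (proj₂ (L.factor M.label M.constant) u))
                         (proj₂ (M.factor L.label L.constant) u)

labelling-unique : {A : List (Hyperedge n)} → Labelling A k₁ → Labelling A k₂ → k₁ ≡ k₂
labelling-unique L M = ℕₚ.≤-antisym (labelling-≤ L M) (labelling-≤ M L)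

someEnd : (e : Hyperedge n) → ∃ λ u → u ∈ ends e
someEnd (hyperedge (u ∷ _) _) = u , here refl

-- All ends of a hyperedge are adjacent to its node, so they share a label. Conversely, a map
-- constant on hyperedges extends to the hyperedge nodes and is then constant along every edge of
-- the incidence graph, hence on components.
κ-labelling : (A : List (Hyperedge n)) → Labelling A (κ (hypergraph A))
κ-labelling {n} A = record
  { label    = label
  ; surj     = vertexIn H
  ; constant = λ e∈A u∈e w∈e → trans (label-end e∈A u∈e) (sym (label-end e∈A w∈e))
  ; factor   = factor
  }
  where
  H = hypergraph A
  module C = Components (components (incidenceGraph H))

  label : Fin n → Fin (κ H)
  label u = C.label (u ↑ˡ length A)

  label-end : ∀ {e u} (e∈A : e ∈ A) → u ∈ ends e → label u ≡ C.label (n ↑ʳ index e∈A)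
  label-end {u = u} e∈A u∈e = C.sound (EqC.return (incident⁺ H (index e∈A)
    (subst (λ e → u ∈ ends e) (lookup-index e∈A) u∈e)))

  factor : ∀ {m} (φ : Fin n → Fin m) → Constant φ A →
           ∃ λ (ψ : Fin (κ H) → Fin m) → ∀ u → ψ (label u) ≡ φ u
  -- The representative that `C.surj` picks in a component may be a hyperedge node, so `φ` is first
  -- extended to all nodes as `φ⁺`.
  factor φ const = φ⁺ ∘ proj₁ ∘ C.surj , λ u →
    trans (φ⁺-connected (C.complete (proj₂ (C.surj (label u)))))
          (cong [ φ , φ-edge ]′ (Finₚ.splitAt-↑ˡ n u (length A)))
    where
    -- A hyperedge node takes the value of `φ` at one of its ends, which exists because of `size>1`;
    -- by constancy every end gives the same value.
    φ-edge : Fin (length A) → Fin _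
    φ-edge = φ ∘ proj₁ ∘ someEnd ∘ lookup A

    φ⁺ : Fin (n + length A) → Fin _
    φ⁺ = [ φ , φ-edge ]′ ∘ splitAt n

    φ⁺-adjacent : ∀ {a b} → Adjacent (incidenceGraph H) a b → φ⁺ a ≡ φ⁺ b
    φ⁺-adjacent ab with incident⁻ H ab
    ... | i , u , u∈e , refl , refl
      rewrite Finₚ.splitAt-↑ˡ n u (length A) | Finₚ.splitAt-↑ʳ n (length A) i =
      const (∈-lookup i) u∈e (proj₂ (someEnd (lookup A i)))

    φ⁺-connected : ∀ {a b} → Connected (incidenceGraph H) a b → φ⁺ a ≡ φ⁺ b
    φ⁺-connected = EqC.fold (On.isEquivalence φ⁺ isEquivalence) φ⁺-adjacent

κ-unique : {A : List (Hyperedge n)} → Labelling A k → κ (hypergraph A) ≡ k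
κ-unique {A = A} = labelling-unique (κ-labelling A)

-- Gluing along a pushout

-- `cover` encodes the uniqueness of the copairing and permits case analysis on elements of the
-- pushout.
record Pushout (p₁ : P → Fin n₁) (p₂ : P → Fin n₂) (n : ℕ) : Set where
  field
    ι₁       : Fin n₁ → Fin n
    ι₂       : Fin n₂ → Fin n
    commutes : ∀ p → ι₁ (p₁ p) ≡ ι₂ (p₂ p)
    cover    : ∀ v → (∃ λ u → ι₁ u ≡ v) ⊎ (∃ λ w → ι₂ w ≡ v)
    copair   : (φ₁ : Fin n₁ → Fin m) (φ₂ : Fin n₂ → Fin m) →
               (∀ p → φ₁ (p₁ p) ≡ φ₂ (p₂ p)) →
               ∃ λ (φ : Fin n → Fin m) → (∀ u → φ (ι₁ u) ≡ φ₁ u) × (∀ w → φ (ι₂ w) ≡ φ₂ w)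

-- `p₁` and `p₂` are arguments so that one construction serves on vertices and, after composition
-- with the labels, on components.
coproduct : (p₁ : ⊥ → Fin n₁) (p₂ : ⊥ → Fin n₂) → Pushout p₁ p₂ (n₁ + n₂)
coproduct {n₁} {n₂} p₁ p₂ = record
  { ι₁       = _↑ˡ n₂
  ; ι₂       = n₁ ↑ʳ_
  ; commutes = λ ()
  ; cover    = cover
  ; copair   = λ φ₁ φ₂ _ → [ φ₁ , φ₂ ]′ ∘ splitAt n₁ ,
      (λ u → cong [ φ₁ , φ₂ ]′ (Finₚ.splitAt-↑ˡ n₁ u n₂)) ,
      (λ w → cong [ φ₁ , φ₂ ]′ (Finₚ.splitAt-↑ʳ n₁ n₂ w))
  }
  where
  cover : ∀ v → (∃ λ u → u ↑ˡ n₂ ≡ v) ⊎ (∃ λ w → n₁ ↑ʳ w ≡ v)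
  cover v with splitAt n₁ v in eq
  ... | inj₁ u = inj₁ (u , Finₚ.splitAt⁻¹-↑ˡ eq)
  ... | inj₂ w = inj₂ (w , Finₚ.splitAt⁻¹-↑ʳ eq)

joinʳ-base : (v₁ : Fin n₁) (v₂ : Fin n₂) → v₁ ↑ˡ pred n₂ ≡ joinʳ v₁ v₂ v₂
joinʳ-base {n₂ = suc _} v₁ v₂ with v₂ Finₚ.≟ v₂
... | yes _    = refl
... | no v₂≢v₂ = contradiction refl v₂≢v₂

joinʳ-punchIn : (v₁ : Fin n₁) (v₂ : Fin (suc n₂)) (w : Fin n₂) →
                joinʳ v₁ v₂ (punchIn v₂ w) ≡ n₁ ↑ʳ w
joinʳ-punchIn {n₁} v₁ v₂ w with v₂ Finₚ.≟ punchIn v₂ w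
... | yes eq = contradiction (sym eq) (Finₚ.punchInᵢ≢i v₂ w)
... | no _   = cong (n₁ ↑ʳ_) (trans (Finₚ.punchOut-cong v₂ refl) (Finₚ.punchOut-punchIn v₂))

wedge : (p₁ : ⊤ → Fin n₁) (p₂ : ⊤ → Fin n₂) → Pushout p₁ p₂ (n₁ + pred n₂)
wedge {n₁} {n₂} p₁ p₂ = record
  { ι₁       = _↑ˡ pred n₂
  ; ι₂       = joinʳ v₁ v₂
  ; commutes = λ _ → joinʳ-base v₁ v₂
  ; cover    = cover v₂
  ; copair   = λ φ₁ φ₂ eq → copair v₂ φ₁ φ₂ (eq tt)
  }
  where
  v₁ = p₁ tt
  v₂ = p₂ tt

  -- `n₂` is quantified afresh: the element `v₂` forces the form `suc n₂`, and matching on it lets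
  -- `pred` and `joinʳ` compute.
  cover : ∀ {n₂} (v₂ : Fin n₂) v →
          (∃ λ u → u ↑ˡ pred n₂ ≡ v) ⊎ (∃ λ w → joinʳ v₁ v₂ w ≡ v)
  cover {suc n₂} v₂ v with splitAt n₁ v in eq
  ... | inj₁ u = inj₁ (u , Finₚ.splitAt⁻¹-↑ˡ eq)
  ... | inj₂ w = inj₂ (punchIn v₂ w ,
    trans (joinʳ-punchIn v₁ v₂ w) (Finₚ.splitAt⁻¹-↑ʳ eq))

  copair : ∀ {n₂ m} (v₂ : Fin n₂) (φ₁ : Fin n₁ → Fin m) (φ₂ : Fin n₂ → Fin m) →
           φ₁ v₁ ≡ φ₂ v₂ →
           ∃ λ (φ : Fin (n₁ + pred n₂) → Fin m) →
             (∀ u → φ (u ↑ˡ pred n₂) ≡ φ₁ u) × (∀ w → φ (joinʳ v₁ v₂ w) ≡ φ₂ w)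
  copair {suc n₂} {m} v₂ φ₁ φ₂ eq = φ , φ-left , φ-right
    where
    φ : Fin (n₁ + n₂) → Fin m
    φ = [ φ₁ , φ₂ ∘ punchIn v₂ ]′ ∘ splitAt n₁

    φ-left : ∀ u → φ (u ↑ˡ n₂) ≡ φ₁ u
    φ-left u = cong [ φ₁ , φ₂ ∘ punchIn v₂ ]′ (Finₚ.splitAt-↑ˡ n₁ u n₂)

    φ-right : ∀ w → φ (joinʳ v₁ v₂ w) ≡ φ₂ w
    φ-right w with v₂ Finₚ.≟ w
    -- `joinʳ` sends `v₂` to the copy of `v₁`, where `φ` takes the value of `φ₁`; this is where
    -- compatibility over the point enters.
    ... | yes refl = trans (φ-left v₁) eq
    ... | no v₂≢w  = trans
      (cong [ φ₁ , φ₂ ∘ punchIn v₂ ]′ (Finₚ.splitAt-↑ʳ n₁ n₂ _))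
      (cong φ₂ (Finₚ.punchIn-punchOut v₂≢w))

-- The hyperedge lists of `_∪_` and `vertexJoin` are both definitionally of this form.
glue : (Fin n₁ → Fin n) → (Fin n₂ → Fin n) →
       List (Hyperedge n₁) → List (Hyperedge n₂) → List (Hyperedge n)
glue f g A B = map (mapHyperedge f) A ++ map (mapHyperedge g) B

module _ {f : Fin n₁ → Fin n} {g : Fin n₂ → Fin n} {X : Set} {φ : Fin n → X}
         {A : List (Hyperedge n₁)} {B : List (Hyperedge n₂)} where

  constant-glue⁺ : Constant (φ ∘ f) A → Constant (φ ∘ g) B → Constant φ (glue f g A B)
  constant-glue⁺ onA onB e∈ u∈e w∈e with ∈-++⁻ (map (mapHyperedge f) A) e∈
  ... | inj₁ e∈A with ∈-map⁻ (mapHyperedge f) e∈A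
  ... | _ , e′∈A , refl with ∈-map⁻ f u∈e | ∈-map⁻ f w∈e
  ... | _ , u′∈e′ , refl | _ , w′∈e′ , refl = onA e′∈A u′∈e′ w′∈e′
  constant-glue⁺ onA onB e∈ u∈e w∈e | inj₂ e∈B with ∈-map⁻ (mapHyperedge g) e∈B
  ... | _ , e′∈B , refl with ∈-map⁻ g u∈e | ∈-map⁻ g w∈e
  ... | _ , u′∈e′ , refl | _ , w′∈e′ , refl = onB e′∈B u′∈e′ w′∈e′

  constant-glue⁻ˡ : Constant φ (glue f g A B) → Constant (φ ∘ f) A
  constant-glue⁻ˡ const e∈A u∈e w∈e =
    const (∈-++⁺ˡ (∈-map⁺ (mapHyperedge f) e∈A)) (∈-map⁺ f u∈e) (∈-map⁺ f w∈e)

  constant-glue⁻ʳ : Constant φ (glue f g A B) → Constant (φ ∘ g) B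
  constant-glue⁻ʳ const e∈B u∈e w∈e =
    const (∈-++⁺ʳ (map (mapHyperedge f) A) (∈-map⁺ (mapHyperedge g) e∈B))
          (∈-map⁺ g u∈e) (∈-map⁺ g w∈e)

-- Coequalizers commute with pushouts: a map on the glued vertices that is constant on the glued
-- hyperedges amounts to a map on each part, constant on the hyperedges there, the two agreeing over
-- `P`.
glue-labelling :
  {p₁ : P → Fin n₁} {p₂ : P → Fin n₂} (V : Pushout p₁ p₂ n) →
  {A : List (Hyperedge n₁)} {B : List (Hyperedge n₂)}
  (L₁ : Labelling A k₁) (L₂ : Labelling B k₂) →
  Pushout (Labelling.label L₁ ∘ p₁) (Labelling.label L₂ ∘ p₂) k →
  Labelling (glue (Pushout.ι₁ V) (Pushout.ι₂ V) A B) k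
glue-labelling {n₁ = n₁} {n₂} {n} {k = k} {p₁ = p₁} {p₂} V {A} {B} L₁ L₂ K = record
  { label    = label
  ; surj     = surj
  ; constant = constant-glue⁺
      (λ e∈A u∈e w∈e → trans (label-ι₁ _)
        (trans (cong K.ι₁ (L₁.constant e∈A u∈e w∈e)) (sym (label-ι₁ _))))
      (λ e∈B u∈e w∈e → trans (label-ι₂ _)
        (trans (cong K.ι₂ (L₂.constant e∈B u∈e w∈e)) (sym (label-ι₂ _))))
  ; factor   = factor
  }
  where
  module V = Pushout V
  module K = Pushout K
  module L₁ = Labelling L₁
  module L₂ = Labelling L₂

  copaired = V.copair (K.ι₁ ∘ L₁.label) (K.ι₂ ∘ L₂.label) K.commutes

  label : Fin n → Fin k
  label = proj₁ copaired

  label-ι₁ : ∀ u → label (V.ι₁ u) ≡ K.ι₁ (L₁.label u)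
  label-ι₁ = proj₁ (proj₂ copaired)

  label-ι₂ : ∀ w → label (V.ι₂ w) ≡ K.ι₂ (L₂.label w)
  label-ι₂ = proj₂ (proj₂ copaired)

  surj : StrictlySurjective _≡_ label
  surj c with K.cover c
  ... | inj₁ (c₁ , refl) = let u , eq = L₁.surj c₁ in
    V.ι₁ u , trans (label-ι₁ u) (cong K.ι₁ eq)
  ... | inj₂ (c₂ , refl) = let w , eq = L₂.surj c₂ in
    V.ι₂ w , trans (label-ι₂ w) (cong K.ι₂ eq)

  factor : ∀ {m} (φ : Fin n → Fin m) → Constant φ (glue V.ι₁ V.ι₂ A B) →
           ∃ λ (ψ : Fin k → Fin m) → ∀ v → ψ (label v) ≡ φ v
  factor φ const
    with ψ₁ , ψ₁-ok ← L₁.factor (φ ∘ V.ι₁) (constant-glue⁻ˡ {g = V.ι₂} {B = B} const)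
    with ψ₂ , ψ₂-ok ← L₂.factor (φ ∘ V.ι₂) (constant-glue⁻ʳ {f = V.ι₁} {A = A} const)
    -- The two factors agree over `P` because both compute `φ` at the same glued vertex.
    with ψ , ψ-ι₁ , ψ-ι₂ ← K.copair ψ₁ ψ₂ (λ p →
           trans (ψ₁-ok (p₁ p)) (trans (cong φ (V.commutes p)) (sym (ψ₂-ok (p₂ p)))))
    = ψ , ψ-ok
    where
    ψ-ok : ∀ v → ψ (label v) ≡ φ v
    ψ-ok v with V.cover v
    ... | inj₁ (u , refl) = trans (cong ψ (label-ι₁ u)) (trans (ψ-ι₁ _) (ψ₁-ok u))
    ... | inj₂ (w , refl) = trans (cong ψ (label-ι₂ w)) (trans (ψ-ι₂ _) (ψ₂-ok w))

-- Components, total size and number of hyperedges after gluing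

suc-+-pred : ∀ a → Fin k → suc (a + pred k) ≡ a + k
suc-+-pred {suc k} a _ = sym (ℕₚ.+-suc a k)

κ-coproduct : (A : List (Hyperedge n₁)) (B : List (Hyperedge n₂)) →
              κ (hypergraph A ∪ hypergraph B) ≡ κ (hypergraph A) + κ (hypergraph B)
κ-coproduct A B = κ-unique (glue-labelling (coproduct (λ ()) (λ ()))
  (κ-labelling A) (κ-labelling B) (coproduct _ _))

-- The component of `v₁` is identified with that of `v₂`, so one component is lost. The latter also
-- witnesses that `B` has a component at all, which makes `pred` exact.
κ-wedge : (A : List (Hyperedge n₁)) (v₁ : Fin n₁) (B : List (Hyperedge n₂)) (v₂ : Fin n₂) →
          suc (κ (vertexJoin (hypergraph A) v₁ (hypergraph B) v₂))
          ≡ κ (hypergraph A) + κ (hypergraph B)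
κ-wedge A v₁ B v₂ = trans
  (cong suc (κ-unique (glue-labelling (wedge (λ _ → v₁) (λ _ → v₂))
    (κ-labelling A) (κ-labelling B) (wedge _ _))))
  (suc-+-pred (κ (hypergraph A)) (Labelling.label (κ-labelling B) v₂))

d-map : (f : Fin n₁ → Fin n₂) (A : List (Hyperedge n₁)) → d (map (mapHyperedge f) A) ≡ d A
d-map f A = cong sum (trans (sym (Listₚ.map-∘ A))
  (Listₚ.map-cong (λ e → Listₚ.length-map f (ends e)) A))

module _ (f : Fin n₁ → Fin n) (g : Fin n₂ → Fin n)
         (A : List (Hyperedge n₁)) (B : List (Hyperedge n₂)) where

  length-glue : length (glue f g A B) ≡ length A + length B
  length-glue = trans (Listₚ.length-++ (map (mapHyperedge f) A))
    (cong₂ _+_ (Listₚ.length-map _ A) (Listₚ.length-map _ B))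

  d-glue : d (glue f g A B) ≡ d A + d B
  d-glue = begin
    d (glue f g A B)                 ≡⟨ cong sum (Listₚ.map-++ size (map (mapHyperedge f) A) _) ⟩
    sum (map size (map (mapHyperedge f) A) ++ map size (map (mapHyperedge g) B))
                                     ≡⟨ sum-++ (map size (map (mapHyperedge f) A)) _ ⟩
    d (map (mapHyperedge f) A) + d (map (mapHyperedge g) B)
                                     ≡⟨ cong₂ _+_ (d-map f A) (d-map g B) ⟩
    d A + d B                        ∎
    where open ≡-Reasoning

-- Sublists of a concatenation

sublists-map : ∀ {a b} {X : Set a} {Y : Set b} (f : X → Y) (xs : List X) →
               sublists (map f xs) ≡ map (map f) (sublists xs)
sublists-map f []       = refl
sublists-map f (x ∷ xs) rewrite sublists-map f xs = begin
  map (f x ∷_) (map (map f) (sublists xs)) ++ map (map f) (sublists xs)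
    ≡⟨ cong (_++ _) (trans (sym (Listₚ.map-∘ (sublists xs))) (Listₚ.map-∘ (sublists xs))) ⟩
  map (map f) (map (x ∷_) (sublists xs)) ++ map (map f) (sublists xs)
    ≡⟨ Listₚ.map-++ (map f) (map (x ∷_) (sublists xs)) (sublists xs) ⟨
  map (map f) (map (x ∷_) (sublists xs) ++ sublists xs) ∎
  where open ≡-Reasoning

module _ {a b c d} {W : Set a} {X : Set b} {Y : Set c} {Z : Set d} where

  cartesianProductWith-mapˡ : (h : X → Y → Z) (f : W → X) (ws : List W) (ys : List Y) →
    cartesianProductWith h (map f ws) ys ≡ cartesianProductWith (λ w → h (f w)) ws ys
  cartesianProductWith-mapˡ h f []       ys = refl
  cartesianProductWith-mapˡ h f (w ∷ ws) ys =
    cong (map (h (f w)) ys ++_) (cartesianProductWith-mapˡ h f ws ys)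

  cartesianProductWith-mapʳ : (h : X → Y → Z) (f : W → Y) (xs : List X) (ws : List W) →
    cartesianProductWith h xs (map f ws) ≡ cartesianProductWith (λ x → h x ∘ f) xs ws
  cartesianProductWith-mapʳ h f []       ws = refl
  cartesianProductWith-mapʳ h f (x ∷ xs) ws =
    cong₂ _++_ (sym (Listₚ.map-∘ ws)) (cartesianProductWith-mapʳ h f xs ws)

  map-cartesianProductWith : (f : Z → W) (h : X → Y → Z) (xs : List X) (ys : List Y) →
    map f (cartesianProductWith h xs ys) ≡ cartesianProductWith (λ x → f ∘ h x) xs ys
  map-cartesianProductWith f h []       ys = refl
  map-cartesianProductWith f h (x ∷ xs) ys = trans (Listₚ.map-++ f (map (h x) ys) _)
    (cong₂ _++_ (sym (Listₚ.map-∘ ys)) (map-cartesianProductWith f h xs ys))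

-- Equality holds with the order included: `sublists` lists the selections containing the head
-- first, and the product runs through its first factor in the outer loop.
sublists-++ : ∀ {a} {X : Set a} (xs ys : List X) →
              sublists (xs ++ ys) ≡ cartesianProductWith _++_ (sublists xs) (sublists ys)
sublists-++ []       ys =
  sym (trans (Listₚ.++-identityʳ _) (Listₚ.map-id (sublists ys)))
sublists-++ (x ∷ xs) ys rewrite sublists-++ xs ys = begin
  map (x ∷_) (cartesianProductWith _++_ S T) ++ cartesianProductWith _++_ S T
    ≡⟨ cong (_++ cartesianProductWith _++_ S T)
         (trans (map-cartesianProductWith (x ∷_) _++_ S T)
                (sym (cartesianProductWith-mapˡ _++_ (x ∷_) S T))) ⟩
  cartesianProductWith _++_ (map (x ∷_) S) T ++ cartesianProductWith _++_ S T
    ≡⟨ Listₚ.cartesianProductWith-distribʳ-++ _++_ (map (x ∷_) S) S T ⟨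
  cartesianProductWith _++_ (map (x ∷_) S ++ S) T ∎
  where
  open ≡-Reasoning
  S = sublists xs
  T = sublists ys

-- This turns the sum over subcollections of the glued hypergraph into a double sum over the two
-- parts.
sublists-glue : (f : Fin n₁ → Fin n) (g : Fin n₂ → Fin n)
                (A : List (Hyperedge n₁)) (B : List (Hyperedge n₂)) →
                sublists (glue f g A B)
                ≡ cartesianProductWith (glue f g) (sublists A) (sublists B)
sublists-glue f g A B = begin
  sublists (glue f g A B)
    ≡⟨ sublists-++ (map (mapHyperedge f) A) _ ⟩
  cartesianProductWith _++_ (sublists (map (mapHyperedge f) A)) (sublists (map (mapHyperedge g) B))
    ≡⟨ cong₂ (cartesianProductWith _++_) (sublists-map _ A) (sublists-map _ B) ⟩
  cartesianProductWith _++_ (map (map (mapHyperedge f)) (sublists A))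
                            (map (map (mapHyperedge g)) (sublists B))
    ≡⟨ cartesianProductWith-mapˡ _++_ _ (sublists A) _ ⟩
  cartesianProductWith (λ A′ → map (mapHyperedge f) A′ ++_) (sublists A)
                       (map (map (mapHyperedge g)) (sublists B))
    ≡⟨ cartesianProductWith-mapʳ _ _ (sublists A) (sublists B) ⟩
  cartesianProductWith (glue f g) (sublists A) (sublists B) ∎
  where open ≡-Reasoning

-- Multiplicativity

∸-+-interchange : ∀ {a b c e} → c ≤ a → e ≤ b → (a + b) ∸ (c + e) ≡ (a ∸ c) + (b ∸ e)
∸-+-interchange {a} {b} {c} {e} c≤a e≤b = begin
  (a + b) ∸ (c + e)  ≡⟨ ℕₚ.∸-+-assoc (a + b) c e ⟨
  a + b ∸ c ∸ e      ≡⟨ cong (_∸ e) (ℕₚ.+-∸-comm b c≤a) ⟩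
  (a ∸ c) + b ∸ e    ≡⟨ ℕₚ.+-∸-assoc (a ∸ c) e≤b ⟩
  (a ∸ c) + (b ∸ e)  ∎
  where open ≡-Reasoning

-- `k` is the number of glued points. Both the minuend and the subtrahend fall short of their sums
-- over the parts by `k`, so it cancels; the inequalities keep the truncated subtractions exact.
∸-split : ∀ k {s t a b c e} → k + s ≡ a + b → k + t ≡ c + e → c ≤ a → e ≤ b →
          s ∸ t ≡ (a ∸ c) + (b ∸ e)
∸-split k {s} {t} ks kt c≤a e≤b = trans (sym (ℕₚ.[m+n]∸[m+o]≡n∸o k s t))
  (trans (cong₂ _∸_ ks kt) (∸-+-interchange c≤a e≤b))

+-gather : ∀ k {z c₁ c₂} a b → k + z ≡ c₁ + c₂ → k + (a + b + z) ≡ (a + c₁) + (b + c₂)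
+-gather k {z} {c₁} {c₂} a b eq = begin
  k + (a + b + z)        ≡⟨ x∙yz≈y∙xz k (a + b) z ⟩
  a + b + (k + z)        ≡⟨ cong (a + b +_) eq ⟩
  a + b + (c₁ + c₂)      ≡⟨ interchange a b c₁ c₂ ⟩
  (a + c₁) + (b + c₂)    ∎
  where
  open ≡-Reasoning
  open CommSemigroupProperties ℕₚ.+-commutativeSemigroup

module _ {c ℓ} (R : CommutativeRing c ℓ) where

  private module R = CommutativeRing R
  open SemiringExp R.semiring using (_^_; ^-homo-*)
  open CommSemigroupProperties R.*-commutativeSemigroup using (interchange)
  open import Relation.Binary.Reasoning.Setoid R.setoid

  private
    ∑ : ∀ {a} {X : Set a} → (X → R.Carrier) → List X → R.Carrier
    ∑ F xs = foldr R._+_ R.0# (map F xs)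

  module _ {a} {X : Set a} where

    ∑-++ : (F : X → R.Carrier) (xs ys : List X) → ∑ F (xs ++ ys) R.≈ ∑ F xs R.+ ∑ F ys
    ∑-++ F []       ys = R.sym (R.+-identityˡ _)
    ∑-++ F (x ∷ xs) ys = R.trans (R.+-congˡ (∑-++ F xs ys)) (R.sym (R.+-assoc _ _ _))

    ∑-map-scale : ∀ {b} {Y : Set b} (F : Y → R.Carrier) (h : X → Y) r (G : X → R.Carrier) xs →
                  (∀ {x} → x ∈ xs → F (h x) R.≈ r R.* G x) →
                  ∑ F (map h xs) R.≈ r R.* ∑ G xs
    ∑-map-scale F h r G []       eq = R.sym (R.zeroʳ r)
    ∑-map-scale F h r G (x ∷ xs) eq = R.trans
      (R.+-cong (eq (here refl)) (∑-map-scale F h r G xs (eq ∘ there)))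
      (R.sym (R.distribˡ r _ _))

  -- This is distributivity. The factorization of `F` is asked only at listed elements, since the
  -- exponents are known to split only for actual subcollections of the hyperedges.
  ∑-cartesianProductWith :
    ∀ {a b c} {X : Set a} {Y : Set b} {Z : Set c}
    (F : Z → R.Carrier) (h : X → Y → Z) (F₁ : X → R.Carrier) (F₂ : Y → R.Carrier) xs ys →
    (∀ {x y} → x ∈ xs → y ∈ ys → F (h x y) R.≈ F₁ x R.* F₂ y) →
    ∑ F (cartesianProductWith h xs ys) R.≈ ∑ F₁ xs R.* ∑ F₂ ys
  ∑-cartesianProductWith F h F₁ F₂ []       ys eq = R.sym (R.zeroˡ _)
  ∑-cartesianProductWith F h F₁ F₂ (x ∷ xs) ys eq = begin
    ∑ F (map (h x) ys ++ cartesianProductWith h xs ys)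
      ≈⟨ ∑-++ F (map (h x) ys) _ ⟩
    ∑ F (map (h x) ys) R.+ ∑ F (cartesianProductWith h xs ys)
      ≈⟨ R.+-cong (∑-map-scale F (h x) (F₁ x) F₂ ys (eq (here refl)))
                  (∑-cartesianProductWith F h F₁ F₂ xs ys (eq ∘ there)) ⟩
    F₁ x R.* ∑ F₂ ys R.+ ∑ F₁ xs R.* ∑ F₂ ys
      ≈⟨ R.distribʳ _ _ _ ⟨
    (F₁ x R.+ ∑ F₁ xs) R.* ∑ F₂ ys ∎

  ^-*-split : ∀ r s i₁ i₂ j₁ j₂ {i j} → i ≡ i₁ + i₂ → j ≡ j₁ + j₂ →
              r ^ i R.* s ^ j R.≈ (r ^ i₁ R.* s ^ j₁) R.* (r ^ i₂ R.* s ^ j₂)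
  ^-*-split r s i₁ i₂ j₁ j₂ refl refl =
    R.trans (R.*-cong (^-homo-* r i₁ i₂) (^-homo-* s j₁ j₂)) (interchange _ _ _ _)

  -- The hypothesis on `κ` ranges over all `A` and `B` because it is used both at each subcollection
  -- and at the full hyperedge lists.
  tutte-glue : ∀ k (f : Fin n₁ → Fin n) (g : Fin n₂ → Fin n) → k + n ≡ n₁ + n₂ →
    (∀ A B → k + κ (hypergraph (glue f g A B)) ≡ κ (hypergraph A) + κ (hypergraph B)) →
    ∀ X Y H₁ H₂ →
    tutte R X Y (hypergraph (glue f g (E H₁) (E H₂))) R.≈ tutte R X Y H₁ R.* tutte R X Y H₂
  tutte-glue {n₁} {n} {n₂} k f g v-glue κ-glue X Y H₁ H₂ = begin
    ∑ (tutteTerm R X Y H) (sublists (E H))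
      ≡⟨ cong (∑ (tutteTerm R X Y H)) (sublists-glue f g (E H₁) (E H₂)) ⟩
    ∑ (tutteTerm R X Y H) (cartesianProductWith (glue f g) (sublists (E H₁)) (sublists (E H₂)))
      ≈⟨ ∑-cartesianProductWith _ _ _ _ (sublists (E H₁)) (sublists (E H₂)) (term _ _) ⟩
    tutte R X Y H₁ R.* tutte R X Y H₂ ∎
    where
    H = hypergraph (glue f g (E H₁) (E H₂))

    term : ∀ A B → A ∈ sublists (E H₁) → B ∈ sublists (E H₂) →
           tutteTerm R X Y H (glue f g A B)
           R.≈ tutteTerm R X Y H₁ A R.* tutteTerm R X Y H₂ B
    term A B A∈ B∈ = ^-*-split (X R.- R.1#) (Y R.- R.1#)
      (κ (hypergraph A) ∸ κ H₁) (κ (hypergraph B) ∸ κ H₂)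
      ((d A + κ (hypergraph A)) ∸ (length A + _)) ((d B + κ (hypergraph B)) ∸ (length B + _))
      (∸-split k (κ-glue A B) (κ-glue (E H₁) (E H₂)) (κ-antitone H₁ A∈) (κ-antitone H₂ B∈))
      -- In the exponent of `Y R.- R.1#`, the shortfall `k` enters the minuend through `κ` and the
      -- subtrahend through the number of vertices; size and number of hyperedges are additive.
      (∸-split k
        (trans (cong (λ z → k + (z + κ (hypergraph (glue f g A B)))) (d-glue f g A B))
               (+-gather k (d A) (d B) (κ-glue A B)))
        (trans (cong (λ z → k + (z + n)) (length-glue f g A B))
               (+-gather k (length A) (length B) v-glue))
        (nullity-nonneg A) (nullity-nonneg B))

proposition2p5 : ∀ {n₁ n₂} (H₁ : Hypergraph n₁) (H₂ : Hypergraph n₂) →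
    (T-HG (H₁ ∪ H₂) ≈ T-HG H₁ * T-HG H₂)
    × (∀ (v₁ : Fin n₁) (v₂ : Fin n₂) →
    T-HG (vertexJoin H₁ v₁ H₂ v₂) ≈ T-HG H₁ * T-HG H₂)
proposition2p5 {n₁} {n₂} H₁ H₂ =
  tutte-glue ℤ[x,y] 0 (_↑ˡ n₂) (n₁ ↑ʳ_) refl κ-coproduct x y H₁ H₂ ,
  -- Here one point is glued, so `k` is `1`; `v₂` witnesses that the second vertex set is nonempty.
  λ v₁ v₂ → tutte-glue ℤ[x,y] 1 (_↑ˡ pred n₂) (joinʳ v₁ v₂) (suc-+-pred n₁ v₂)
    (λ A B → κ-wedge A v₁ B v₂) x y H₁ H₂
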